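{- Let $\ell\ge 4$ be even and $m\ge 1$ odd with $\ell+m\equiv 1\pmod 4$. Then there exists an $\mathcal{AL}\!\left(\frac{\ell+m-1}{4},\,3\cdot\frac{\ell+m-1}{4}+1\right)$ of $[\ell\mid m]$ whenever either $m\in\{1,3\}$ and $\ell\ge 8$, or $m\ge \ell+5$.
   Context: $\mathcal{I}(a,b)=\{x\in\mathbb{Z}\mid a\le x\le b\}$. $[\ell\mid m]$ is the vertex-disjoint union of an $\ell$-cycle and a path with $m$ edges; its number of edges is $\epsilon=\ell+m$. A labeling is an isomorphic copy with distinct integer vertices; $\Delta\Gamma$ is the multiset of differences $x-y$ over ordered pairs of adjacent vertices. An $\mathcal{AL}(x,y)$ ($\alpha$-labeling with path ends $x,y$) of a bipartite graph of this type with $\epsilon$ edges is a labeling $\Gamma$ with vertex set $\mathcal{I}(0,\epsilon)$ such that every edge joins a vertex of $\mathcal{I}(0,\lfloor(\epsilon-1)/2\rfloor)$ to a vertex of $\mathcal{I}(\lfloor(\epsilon+1)/2\rfloor,\epsilon)$, the end-vertices of the path are $x$ and $y$, and $\Delta\Gamma=\pm\mathcal{I}(1,\epsilon)$. -}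

module Defs where

open import Data.Nat using (ℕ; zero; suc; _+_; _*_; _∸_; _≤_)
open import Data.Nat.DivMod using (_/_)
open import Data.Integer using (ℤ; +_; -_) renaming (_-_ to _-ℤ_)
open import Data.List using (List; []; _∷_; _++_; map; concatMap; upTo; length; head; last)
open import Data.List.Membership.Propositional using (_∈_)
open import Data.List.Relation.Unary.Unique.Propositional using (Unique)
open import Data.List.Relation.Binary.Permutation.Propositional using (_↭_)
open import Data.Product using (_×_; _,_)
open import Data.Sum using (_⊎_)
open import Data.Maybe using (just)
open import Function.Bundles using (_⇔_)
open import Relation.Binary.PropositionalEquality using (_≡_)
open import Data.List.Relation.Unary.All using (All)

-- A labeling of [ℓ | m] is given by two lists of (natural-number) vertex labels:
--   cyc = (c₀, …, c_{ℓ-1})  the cycle  c₀ c₁ … c_{ℓ-1} c₀   (length ℓ)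
--   pth = (p₀, …, p_m)       the path   p₀ p₁ … p_m          (length m+1)

pathEdges : List ℕ → List (ℕ × ℕ)
pathEdges []           = []
pathEdges (x ∷ [])     = []
pathEdges (x ∷ y ∷ xs) = (x , y) ∷ pathEdges (y ∷ xs)

cycleEdges : List ℕ → List (ℕ × ℕ)
cycleEdges []       = []
cycleEdges (c ∷ cs) = pathEdges ((c ∷ cs) ++ (c ∷ []))

edges : List ℕ → List ℕ → List (ℕ × ℕ)
edges cyc pth = cycleEdges cyc ++ pathEdges pth

ΔΓ : List (ℕ × ℕ) → List ℤ
ΔΓ = concatMap (λ { (u , v) → ((+ u) -ℤ (+ v)) ∷ ((+ v) -ℤ (+ u)) ∷ [] })

±I1 : ℕ → List ℤ
±I1 ε = concatMap (λ k → (+ suc k) ∷ (- (+ suc k)) ∷ []) (upTo ε)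

Crossing : ℕ → ℕ × ℕ → Set
Crossing ε (u , v) =
  (u ≤ (ε ∸ 1) / 2 × (ε + 1) / 2 ≤ v × v ≤ ε) ⊎
  (v ≤ (ε ∸ 1) / 2 × (ε + 1) / 2 ≤ u × u ≤ ε)

record IsAL (ℓ m x y : ℕ) (cyc pth : List ℕ) : Set where
  field
    cycLength : length cyc ≡ ℓ
    pthLength : length pth ≡ suc m
    distinct  : Unique (cyc ++ pth)
    vertexSet : ∀ z → (z ∈ (cyc ++ pth)) ⇔ (z ≤ ℓ + m)
    bipartite : All (Crossing (ℓ + m)) (edges cyc pth)
    ends      : (head pth ≡ just x × last pth ≡ just y) ⊎
                (head pth ≡ just y × last pth ≡ just x)
    labeling  : ΔΓ (edges cyc pth) ↭ ±I1 (ℓ + m)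

{-# OPTIONS --safe #-}
module Submission where

-- Write ε = 4k + 1 and N = 2k + 1, and split the labels into rows 0 … 2k and columns
-- N … N + 2k; an α-labeling is then a set of cells of an N × N grid, one on each diagonal.
-- Two operations surround such a configuration, shifted to the centre, by an upper right and
-- a lower left s × s block:
--   * a zigzag through each block lengthens the cycle by 4s, if it has a suitable edge;
--   * if the path has an edge (x , x) on the main diagonal with x < s, that edge is replaced by
--     an α-labeled path through each block, one being the transpose of the other, joined by a
--     new edge on the main diagonal.  This lengthens the path by 4s.
-- The second operation needs α-labeled paths on 2s vertices that start in a prescribed row;
-- these are built by cutting off zigzags, as in the Euclidean algorithm.
-- It remains to label [ℓ | 1] and [ℓ | 3], where finitely many initial cases and the first
-- operation suffice, and to treat ℓ = 4 and ℓ = 6 with a few initial cases of their own.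

open import Defs
open import Data.Nat using (ℕ; zero; suc; _+_; _*_; _∸_; _≤_; _<_; _≥_; z≤n; s≤s; compare; less; equal; greater)
open import Data.Nat.DivMod using (_/_; _%_; m*n/n≡m; m≡m%n+[m/n]*n)
open import Data.Nat.Divisibility using (_∣_; divides; divides-refl; ∣m+n∣m⇒∣n)
open import Data.Nat.Induction using (<-wellFounded; Acc; acc)
open import Data.Nat.Properties
open import Data.Nat.Tactic.RingSolver using (solve-∀)
open import Data.Integer using (ℤ; -_) renaming (+_ to pos; _-_ to _-ℤ_; _+_ to _+ℤ_)
open import Data.Integer.Tactic.RingSolver using () renaming (solve-∀ to ℤ-solve-∀)
open import Data.Bool using (T)
open import Data.Empty using (⊥)
open import Data.List using (List; []; _∷_; _++_; map; concatMap; upTo; applyUpTo; length; head; last; [_])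
open import Data.List.Properties using (map-++; map-id; map-upTo; concatMap-map; concatMap-++; length-++; length-map)
open import Data.List.Membership.Propositional.Properties using (∈-upTo⁺; ∈-upTo⁻)
open import Data.List.Relation.Binary.Permutation.Propositional using (_↭_; refl; prep; swap; trans; ↭-refl; ↭-sym; ↭-trans; ↭-reflexive; ↭⇒↭ₛ; module PermutationReasoning)
open import Data.List.Relation.Binary.Permutation.Propositional.Properties using (++-comm; ++⁺; ++⁺ˡ; ++⁺ʳ; map⁺; All-resp-↭; ∈-resp-↭; shifts; ++-commutativeMonoid; ↭-length)
import Data.List.Relation.Binary.Permutation.Setoid.Properties as PermutationSetoid
open import Data.List.Relation.Unary.All using (All; []; _∷_)
import Data.List.Relation.Unary.All.Properties as AllP
open import Data.List.Relation.Unary.Unique.Propositional.Properties using (upTo⁺)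
open import Data.Maybe using (Maybe; just; nothing; is-just; to-witness-T)
open import Data.Product using (Σ; ∃; _×_; _,_)
open import Data.Sum using (_⊎_; inj₁; inj₂)
open import Function using (_∘_; id)
open import Function.Bundles using (mk⇔)
open import Relation.Binary.Definitions using (DecidableEquality)
open import Relation.Binary.PropositionalEquality using (_≡_; refl; sym; cong; cong₂; subst; subst₂; setoid; module ≡-Reasoning)
import Relation.Binary.PropositionalEquality as ≡
open import Relation.Nullary using (¬_; yes; no; contradiction)
open import Relation.Nullary.Decidable using (map′)
import Algebra.Solver.CommutativeMonoid as CMSolver

-- Paths in a grid

-- Lists under `++` form a commutative monoid up to `↭`, so the regrouping of blocks is left to a
-- solver.
module Bag {A : Set} = CMSolver (++-commutativeMonoid {A = A}) using (solve; _⊕_; _⊜_)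

-- In a grid of size N, the row r a carries the label a and the column c b the label b + N.
data V : Set where
  r c : ℕ → V

-- Δ N u v δ: the labels of u and v differ by δ, written without subtraction.
Δ : ℕ → V → V → ℕ → Set
Δ N (r a) (c b) δ = a + δ ≡ b + N
Δ N (c b) (r a) δ = a + δ ≡ b + N
Δ N _     _     _ = ⊥

-- The indices are the ends of the path and, up to permutation, its vertices and edge differences.
data Walk (N : ℕ) : V → V → List V → List ℕ → Set where
  ⟨_⟩ : ∀ v → Walk N v v [ v ] []
  step : ∀ {u v w δ vs ds} → Δ N u v δ → Walk N v w vs ds → Walk N u w (u ∷ vs) (δ ∷ ds)
  perm : ∀ {u w vs vs′ ds ds′} → vs ↭ vs′ → ds ↭ ds′ → Walk N u w vs ds → Walk N u w vs′ ds′

infixr 5 _—⟨_⟩_ _▷⟨_⟩_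

_—⟨_⟩_ : ∀ {N} u {v w δ vs ds} → Δ N u v δ → Walk N v w vs ds → Walk N u w (u ∷ vs) (δ ∷ ds)
u —⟨ e ⟩ t = step e t

_▷⟨_⟩_ : ∀ {N u v w z δ vs ws ds es} → Walk N u v vs ds → Δ N v w δ → Walk N w z ws es →
  Walk N u z (vs ++ ws) (ds ++ δ ∷ es)
⟨ v ⟩      ▷⟨ e ⟩ t′ = step e t′
step e₁ t  ▷⟨ e ⟩ t′ = step e₁ (t ▷⟨ e ⟩ t′)
perm p q t ▷⟨ e ⟩ t′ = perm (++⁺ʳ _ p) (++⁺ʳ _ q) (t ▷⟨ e ⟩ t′)

Δ-sym : ∀ {N} u v {δ} → Δ N u v δ → Δ N v u δ
Δ-sym (r a) (c b) e = e
Δ-sym (c b) (r a) e = e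

-- This is where `perm` pays off: a reversed path has the same vertices and differences up to order,
-- so only the ends are exchanged in the type.
reverse : ∀ {N u v vs ds} → Walk N u v vs ds → Walk N v u vs ds
reverse ⟨ v ⟩ = ⟨ v ⟩
reverse (step {u} {v} e t) = perm (++-comm _ [ u ]) (++-comm _ [ _ ]) (reverse t ▷⟨ Δ-sym u v e ⟩ ⟨ u ⟩)
reverse (perm p q t) = perm p q (reverse t)

sh : ℕ → ℕ → V → V
sh i j (r a) = r (i + a)
sh i j (c b) = c (j + b)

-- Row labels rise by `i` and column labels by `j` plus the growth from `N` to `N′`. Every
-- difference therefore grows by the same `e`, fixed by the hypothesis without subtraction.
Δ-shift : ∀ {N N′} i j e → i + (e + N) ≡ j + N′ → ∀ u v {δ} → Δ N u v δ → Δ N′ (sh i j u) (sh i j v) (e + δ)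
Δ-shift {N} {N′} i j e h = go
  where
  open ≡-Reasoning
  regroup₁ : ∀ i a e δ → i + a + (e + δ) ≡ i + e + (a + δ)
  regroup₁ = solve-∀
  regroup₂ : ∀ i e b N → i + e + (b + N) ≡ b + (i + (e + N))
  regroup₂ = solve-∀
  regroup₃ : ∀ j b N → b + (j + N) ≡ j + b + N
  regroup₃ = solve-∀
  lemma : ∀ a b {δ} → a + δ ≡ b + N → i + a + (e + δ) ≡ j + b + N′
  lemma a b {δ} p = begin
    i + a + (e + δ)   ≡⟨ regroup₁ i a e δ ⟩
    i + e + (a + δ)   ≡⟨ cong (i + e +_) p ⟩
    i + e + (b + N)   ≡⟨ regroup₂ i e b N ⟩
    b + (i + (e + N)) ≡⟨ cong (b +_) h ⟩
    b + (j + N′)      ≡⟨ regroup₃ j b N′ ⟩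
    j + b + N′        ∎
  go : ∀ u v {δ} → Δ N u v δ → Δ N′ (sh i j u) (sh i j v) (e + δ)
  go (r a) (c b) p = lemma a b p
  go (c b) (r a) p = lemma a b p

translate : ∀ {N N′} i j e → i + (e + N) ≡ j + N′ → ∀ {u v vs ds} → Walk N u v vs ds →
  Walk N′ (sh i j u) (sh i j v) (map (sh i j) vs) (map (e +_) ds)
translate i j e h ⟨ v ⟩ = ⟨ sh i j v ⟩
translate i j e h (step {u} {v} p t) = step (Δ-shift i j e h u v p) (translate i j e h t)
translate i j e h (perm p q t) = perm (map⁺ _ p) (map⁺ _ q) (translate i j e h t)

flip : V → V
flip (r a) = c a
flip (c b) = r b

-- Reflection in the main diagonal exchanges `b + N - a` and `a + N - b`, whose sum is `N + N`. The
-- bound on `δ` makes the truncated subtraction exact.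
Δ-flip : ∀ {N} u v {δ} → δ ≤ N + N → Δ N u v δ → Δ N (flip u) (flip v) (N + N ∸ δ)
Δ-flip {N} = go
  where
  open ≡-Reasoning
  regroup : ∀ a δ N → a + δ + N ≡ a + N + δ
  regroup = solve-∀
  lemma : ∀ a b {δ} → δ ≤ N + N → a + δ ≡ b + N → b + (N + N ∸ δ) ≡ a + N
  lemma a b {δ} l p = +-cancelʳ-≡ δ _ _ (begin
    b + (N + N ∸ δ) + δ   ≡⟨ +-assoc b (N + N ∸ δ) δ ⟩
    b + (N + N ∸ δ + δ)   ≡⟨ cong (b +_) (m∸n+n≡m l) ⟩
    b + (N + N)           ≡⟨ sym (+-assoc b N N) ⟩
    b + N + N             ≡⟨ cong (_+ N) (sym p) ⟩
    a + δ + N             ≡⟨ regroup a δ N ⟩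
    a + N + δ             ∎)
  go : ∀ u v {δ} → δ ≤ N + N → Δ N u v δ → Δ N (flip u) (flip v) (N + N ∸ δ)
  go (r a) (c b) l p = lemma a b l p
  go (c b) (r a) l p = lemma a b l p

transpose : ∀ {N u v vs ds} → Walk N u v vs ds → All (_≤ N + N) ds →
  Walk N (flip u) (flip v) (map flip vs) (map (N + N ∸_) ds)
transpose ⟨ v ⟩ _ = ⟨ flip v ⟩
transpose (step {u} {v} p t) (l ∷ ls) = step (Δ-flip u v l p) (transpose t ls)
transpose (perm p q t) ls = perm (map⁺ _ p) (map⁺ _ q) (transpose t (All-resp-↭ (↭-sym q) ls))

-- Intervals, grids and tiles

seg : {A : Set} → (ℕ → A) → ℕ → ℕ → List A
seg f a zero    = []
seg f a (suc n) = f a ∷ seg f (suc a) n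

seg-++ : {A : Set} (f : ℕ → A) → ∀ a m {b n p} → a + m ≡ b → m + n ≡ p → seg f a m ++ seg f b n ≡ seg f a p
seg-++ f a zero    refl refl rewrite +-identityʳ a = refl
seg-++ f a (suc m) refl refl = cong (f a ∷_) (seg-++ f (suc a) m (sym (+-suc a m)) refl)

seg-map : {A B : Set} {f : ℕ → A} {g : A → B} {h : ℕ → B} → ∀ i → (∀ x → g (f x) ≡ h (i + x)) →
  ∀ a n → map g (seg f a n) ≡ seg h (i + a) n
seg-map i eq a zero    = refl
seg-map {h = h} i eq a (suc n) = cong₂ _∷_ (eq a) (≡.trans (seg-map i eq (suc a) n) (cong (λ z → seg h z n) (+-suc i a)))

seg-snoc : {A : Set} (f : ℕ → A) → ∀ a n → f (a + n) ∷ seg f a n ↭ seg f a (suc n)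
seg-snoc f a n = trans (++-comm [ f (a + n) ] (seg f a n)) (↭-reflexive (seg-++ f a n refl (+-comm n 1)))

-- The reflection reverses an interval, hence only `↭`. The hypothesis says that the first entry `a`
-- and the last image entry `b + n - 1` add up to `T`.
seg-∸ : ∀ T a b n → a + b + n ≡ suc T → map (T ∸_) (seg id a n) ↭ seg id b n
seg-∸ T a b zero    h = refl
seg-∸ T a b (suc n) h = trans (trans (prep _ (seg-∸ T (suc a) b n (≡.trans (sym (+-suc (a + b) n)) h)))
  (↭-reflexive (cong (_∷ seg id b n) T∸a))) (seg-snoc id b n)
  where
  regroup : ∀ a b n → a + b + suc n ≡ suc (a + (b + n))
  regroup = solve-∀
  T∸a : T ∸ a ≡ b + n
  T∸a = ≡.trans (cong (_∸ a) (suc-injective (≡.trans (sym h) (regroup a b n)))) (m+n∸m≡n a (b + n))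

seg-All : ∀ T a n → a + n ≤ suc T → All (_≤ T) (seg id a n)
seg-All T a zero    h = []
seg-All T a (suc n) h = ≤-trans (m≤m+n a n) (≤-pred (≤-trans (≤-reflexive (sym (+-suc a n))) h))
                      ∷ seg-All T (suc a) n (≤-trans (≤-reflexive (sym (+-suc a n))) h)

grid : ℕ → List V
grid n = seg r 0 n ++ seg c 0 n

-- On rows and columns below `n` the difference `b + n - a` takes these values, one for each
-- diagonal of the grid.
deltas : ℕ → List ℕ
deltas n = seg id 1 (n + n ∸ 1)

-- The differences of one block come first, then a single value reserved for a linking edge, then
-- the raised differences of a second block.
deltas-join : ∀ a b → deltas (suc a) ++ (suc a + suc a) ∷ map ((suc a + suc a) +_) (deltas (suc b)) ≡ deltas (suc a + suc b)
deltas-join a b = begin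
  deltas (suc a) ++ (suc a + suc a) ∷ map ((suc a + suc a) +_) (deltas (suc b))
    ≡⟨ cong (λ z → deltas (suc a) ++ (suc a + suc a) ∷ z) (seg-map (suc a + suc a) (λ _ → refl) 1 (b + suc b)) ⟩
  deltas (suc a) ++ (suc a + suc a) ∷ seg id (suc a + suc a + 1) (b + suc b)
    ≡⟨ cong (λ z → deltas (suc a) ++ (suc a + suc a) ∷ seg id z (b + suc b)) (+-comm (suc a + suc a) 1) ⟩
  deltas (suc a) ++ seg id (suc a + suc a) (suc (b + suc b))
    ≡⟨ seg-++ id 1 (a + suc a) refl (total a b) ⟩
  deltas (suc a + suc b) ∎
  where
  open ≡-Reasoning
  total : ∀ a b → a + suc a + suc (b + suc b) ≡ a + suc b + suc (a + suc b)
  total = solve-∀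

-- An α-labeling of the path on `n + n` vertices: each row, each column and each diagonal is used
-- once.
Tile : ℕ → V → V → Set
Tile n u v = Walk n u v (grid n) (deltas n)

map-sh-grid : ∀ i j n → map (sh i j) (grid n) ≡ seg r i n ++ seg c j n
map-sh-grid i j n = ≡.trans (map-++ (sh i j) (seg r 0 n) (seg c 0 n))
  (cong₂ _++_ (≡.trans (seg-map i (λ _ → refl) 0 n) (cong (λ z → seg r z n) (+-identityʳ i)))
              (≡.trans (seg-map j (λ _ → refl) 0 n) (cong (λ z → seg c z n) (+-identityʳ j))))

-- Complementing to twice the size maps the interval of all differences onto itself.
transpose-Tile : ∀ {n u v} → Tile (suc n) u v → Tile (suc n) (flip u) (flip v)
transpose-Tile {n} t = perm vs (seg-∸ (suc n + suc n) 1 1 (n + suc n) refl)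
    (transpose t (seg-All (suc n + suc n) 1 (n + suc n) (n≤1+n _)))
  where
  vs : map flip (grid (suc n)) ↭ grid (suc n)
  vs = trans (↭-reflexive (≡.trans (map-++ flip (seg r 0 (suc n)) (seg c 0 (suc n)))
         (cong₂ _++_ (seg-map 0 (λ _ → refl) 0 (suc n)) (seg-map 0 (λ _ → refl) 0 (suc n)))))
       (++-comm (seg c 0 (suc n)) (seg r 0 (suc n)))

-- Paths with all differences and a prescribed first row

-- `X` goes to the upper right block and takes the large differences, `Y` to the lower left block
-- and keeps its own. The one value between them, `suc n + suc n`, is what the linking edge must
-- have.
join : ∀ m n {u v w z} → Δ (suc m + suc n) (sh 0 (suc n) v) (sh (suc m) 0 w) (suc n + suc n) →
  Tile (suc m) u v → Tile (suc n) w z → Tile (suc m + suc n) (sh 0 (suc n) u) (sh (suc m) 0 z)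
join m n e X Y = perm vs ds
  (translate 0 (suc n) (suc n + suc n) (offsetX (suc m) (suc n)) X ▷⟨ e ⟩ translate (suc m) 0 0 refl Y)
  where
  offsetX : ∀ m n → n + n + m ≡ n + (m + n)
  offsetX = solve-∀
  vs : map (sh 0 (suc n)) (grid (suc m)) ++ map (sh (suc m) 0) (grid (suc n)) ↭ grid (suc m + suc n)
  vs = begin
    map (sh 0 (suc n)) (grid (suc m)) ++ map (sh (suc m) 0) (grid (suc n))
      ≡⟨ cong₂ _++_ (map-sh-grid 0 (suc n) (suc m)) (map-sh-grid (suc m) 0 (suc n)) ⟩
    (seg r 0 (suc m) ++ seg c (suc n) (suc m)) ++ (seg r (suc m) (suc n) ++ seg c 0 (suc n))
      ↭⟨ solve 4 (λ p q x y → (p ⊕ q) ⊕ (x ⊕ y) ⊜ (p ⊕ x) ⊕ (y ⊕ q)) ↭-refl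
           (seg r 0 (suc m)) (seg c (suc n) (suc m)) (seg r (suc m) (suc n)) (seg c 0 (suc n)) ⟩
    (seg r 0 (suc m) ++ seg r (suc m) (suc n)) ++ (seg c 0 (suc n) ++ seg c (suc n) (suc m))
      ≡⟨ cong₂ _++_ (seg-++ r 0 (suc m) refl refl) (seg-++ c 0 (suc n) refl (+-comm (suc n) (suc m))) ⟩
    grid (suc m + suc n) ∎
    where open Bag
          open PermutationReasoning
  ds : map ((suc n + suc n) +_) (deltas (suc m)) ++ (suc n + suc n) ∷ map id (deltas (suc n)) ↭ deltas (suc m + suc n)
  ds = begin
    map ((suc n + suc n) +_) (deltas (suc m)) ++ [ suc n + suc n ] ++ map id (deltas (suc n))
      ≡⟨ cong (λ z → map ((suc n + suc n) +_) (deltas (suc m)) ++ [ suc n + suc n ] ++ z) (map-id _) ⟩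
    map ((suc n + suc n) +_) (deltas (suc m)) ++ [ suc n + suc n ] ++ deltas (suc n)
      ↭⟨ solve 3 (λ p q x → p ⊕ q ⊕ x ⊜ x ⊕ q ⊕ p) ↭-refl (map ((suc n + suc n) +_) (deltas (suc m))) [ suc n + suc n ] (deltas (suc n)) ⟩
    deltas (suc n) ++ [ suc n + suc n ] ++ map ((suc n + suc n) +_) (deltas (suc m))
      ≡⟨ deltas-join n m ⟩
    deltas (suc n + suc m)
      ≡⟨ cong deltas (+-comm (suc n) (suc m)) ⟩
    deltas (suc m + suc n) ∎
    where open Bag
          open PermutationReasoning

-- The same blocks, but linked from the end of `Y` to the start of `X`, so that the path begins in
-- the lower left block.
joinʳ : ∀ m n {u v w z} → Δ (suc m + suc n) (sh 0 (suc n) u) (sh (suc m) 0 z) (suc n + suc n) →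
  Tile (suc m) u v → Tile (suc n) w z → Tile (suc m + suc n) (sh (suc m) 0 w) (sh 0 (suc n) v)
joinʳ m n e X Y = reverse (join m n e (reverse X) (reverse Y))

unit : Tile 1 (r 0) (c 0)
unit = r 0 —⟨ refl ⟩ ⟨ c 0 ⟩

-- The zigzag `r n`, `c 0`, `r (n - 1)`, `c 1`, ..., `r 0`, `c n`, built by adding one edge at the
-- lower left.
hiZigzag : ∀ n → Tile (suc n) (r n) (c n)
hiZigzag zero    = unit
hiZigzag (suc n) = subst (λ k → Tile k (r (suc n)) (c (suc n))) (+-comm (suc n) 1)
  (subst (λ k → Tile (suc n + 1) (r k) (c (suc n))) (+-identityʳ (suc n))
    (joinʳ n 0 (link n) (hiZigzag n) unit))
  where
  link : ∀ n → n + 2 ≡ 0 + (suc n + 1)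
  link = solve-∀

-- The zigzag `r 0`, `c n`, `r 1`, `c (n - 1)`, ..., `r n`, `c 0`, built by adding one edge at the
-- upper right.
loZigzag : ∀ n → Tile (suc n) (r 0) (c 0)
loZigzag zero    = unit
loZigzag (suc n) = join 0 n (link n) unit (loZigzag n)
  where
  link : ∀ n → 1 + (suc n + suc n) ≡ suc n + 0 + (1 + suc n)
  link = solve-∀

Abrham : ℕ → ℕ → Set
Abrham n j = ∃ λ i → Tile n (r j) (c i)

-- From the middle row `k` an edge of difference `k + k` leads to a zigzag in a lower left block,
-- which has all smaller differences. Then come the corner edge of difference `N`, the edge of
-- maximal difference `k + k + N`, and a zigzag in an upper right block with the values in between.
abrham-centre : ∀ j → Abrham (suc (j + j)) j
abrham-centre zero    = 0 , unit
abrham-centre (suc j) = k + 0 , perm vs ds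
  ( r k —⟨ sym (+-suc j (k + k)) ⟩ (translate (suc k) 0 0 refl (reverse (hiZigzag j))
     ▷⟨ cong (_+ N) (sym (+-suc k j)) ⟩ (c (k + k) —⟨ refl ⟩ translate 0 k N (+-comm N k) (loZigzag j))))
  where
  k = suc j
  N = suc (k + k)
  open PermutationReasoning
  open Bag
  vs : r k ∷ map (sh (suc k) 0) (grid k) ++ c (k + k) ∷ map (sh 0 k) (grid k) ↭ grid N
  vs = begin
    [ r k ] ++ map (sh (suc k) 0) (grid k) ++ [ c (k + k) ] ++ map (sh 0 k) (grid k)
      ≡⟨ cong₂ (λ x y → [ r k ] ++ x ++ [ c (k + k) ] ++ y) (map-sh-grid (suc k) 0 k) (map-sh-grid 0 k k) ⟩
    [ r k ] ++ (seg r (suc k) k ++ seg c 0 k) ++ [ c (k + k) ] ++ (seg r 0 k ++ seg c k k)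
      ↭⟨ solve 6 (λ x y a b p q → x ⊕ (a ⊕ b) ⊕ y ⊕ (p ⊕ q) ⊜ (p ⊕ (x ⊕ a)) ⊕ (b ⊕ (q ⊕ y))) ↭-refl
           [ r k ] [ c (k + k) ] (seg r (suc k) k) (seg c 0 k) (seg r 0 k) (seg c k k) ⟩
    (seg r 0 k ++ seg r k (suc k)) ++ (seg c 0 k ++ (seg c k k ++ seg c (k + k) 1))
      ≡⟨ cong₂ _++_ (seg-++ r 0 k refl (+-suc k k))
           (≡.trans (cong (seg c 0 k ++_) (seg-++ c k k refl (+-comm k 1))) (seg-++ c 0 k refl (+-suc k k))) ⟩
    grid N ∎
  length≡ : ∀ j → (j + suc j + 2) + (j + suc j + 1) ≡ suc j + suc j + suc (suc j + suc j)
  length≡ = solve-∀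
  start≡ : ∀ j → suc (suc j + suc j) + 1 + (j + suc j) ≡ suc j + suc j + suc (suc j + suc j)
  start≡ = solve-∀
  middle≡ : ∀ j → 1 + (j + suc j + 2) ≡ suc (suc j + suc j) + 1
  middle≡ = solve-∀
  ds : (k + k) ∷ map id (deltas k) ++ N ∷ (k + k + N) ∷ map (N +_) (deltas k) ↭ deltas N
  ds = begin
    [ k + k ] ++ map id (deltas k) ++ [ N ] ++ [ k + k + N ] ++ map (N +_) (deltas k)
      ≡⟨ cong₂ (λ x y → [ k + k ] ++ x ++ [ N ] ++ [ k + k + N ] ++ y) (map-id _) (seg-map N (λ _ → refl) 1 (j + k)) ⟩
    [ k + k ] ++ deltas k ++ [ N ] ++ [ k + k + N ] ++ seg id (N + 1) (j + k)
      ↭⟨ solve 5 (λ x y z a b → x ⊕ a ⊕ y ⊕ z ⊕ b ⊜ (a ⊕ (x ⊕ y)) ⊕ (b ⊕ z)) ↭-refl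
           [ k + k ] [ N ] [ k + k + N ] (deltas k) (seg id (N + 1) (j + k)) ⟩
    (deltas k ++ seg id (k + k) 2) ++ (seg id (N + 1) (j + k) ++ seg id (k + k + N) 1)
      ≡⟨ cong₂ _++_ (seg-++ id 1 (j + k) refl refl) (seg-++ id (N + 1) (j + k) (start≡ j) refl) ⟩
    seg id 1 (j + k + 2) ++ seg id (N + 1) (j + k + 1)
      ≡⟨ seg-++ id 1 (j + k + 2) (middle≡ j) (length≡ j) ⟩
    deltas N ∎

-- The grid has size n = j + q + 1.  A zigzag through a corner block of size min(j , q) + 1 that
-- starts at row j leaves the same problem on the remaining block.
abrham : ∀ j q → Abrham (suc (j + q)) j
abrham j q = go j q (<-wellFounded (j + q))
  where
  go : ∀ j q → Acc _<_ (j + q) → Abrham (suc (j + q)) j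
  go j q (acc rec) with compare j q
  ... | equal j  = abrham-centre j
  -- Row `j` is the last row of the upper right corner block; the linking diagonal forces the
  -- remaining path to start in its own row `j` again.
  ... | less j k with go j k (rec (+-monoʳ-< j (m<n+m k (s≤s z≤n))))
  ...   | i , t = i , join j (j + k) (link j k) (hiZigzag j) t
    where
    link : ∀ j k → suc j + j + (suc (j + k) + suc (j + k)) ≡ suc (j + k) + j + (suc j + suc (j + k))
    link = solve-∀
  -- Row `j` is now the first row of the lower left corner block, and the remaining path has to
  -- start in row `k = j - q - 1`.
  go j q (acc rec) | greater q k with go k q (rec (subst (_< suc (q + k) + q) (+-comm q k) (m≤m+n (suc (q + k)) q)))
  ...   | i , t = suc q + i , subst (λ n → Tile n (r (suc (q + k))) (c (suc q + i))) (size k q)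
            (subst (λ a → Tile (suc (k + q) + suc q) (r a) (c (suc q + i))) (start k q)
              (joinʳ (k + q) q (link k q) t (loZigzag q)))
    where
    link : ∀ k q → k + (suc q + suc q) ≡ 0 + (suc (k + q) + suc q)
    link = solve-∀
    start : ∀ k q → suc (k + q) + 0 ≡ suc (q + k)
    start = solve-∀
    size : ∀ k q → suc (k + q) + suc q ≡ suc (suc (q + k) + q)
    size = solve-∀

-- Enlarging a labeling

odd : ℕ → ℕ
odd k = suc (k + k)

-- Row `k` and column `k` carry the required end labels `k` and `N + k = 3k + 1`; the path may run
-- in either direction.
data Ends (k : ℕ) : V → V → Set where
  row-first : Ends k (r k) (c k)
  col-first : Ends k (c k) (r k)

record Labeling (k ℓ m : ℕ) : Set where
  field
    {a b u w}   : V
    {vc vp}     : List V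
    {dc dp}     : List ℕ
    {δ}         : ℕ
    ends        : Ends k u w
    cyc         : Walk (odd k) a b vc dc
    closing     : Δ (odd k) b a δ
    pth         : Walk (odd k) u w vp dp
    vertices    : vc ++ vp ↭ grid (odd k)
    differences : (δ ∷ dc) ++ dp ↭ deltas (odd k)
    cycLength   : length vc ≡ ℓ
    pthLength   : length vp ≡ suc m

-- A labeling whose path has the edge r x — c x on the main diagonal.
record Core (k x α β ℓ m : ℕ) : Set where
  field
    {u w}       : V
    {vc vp vq}  : List V
    {dc dp dq}  : List ℕ
    {δ}         : ℕ
    ends        : Ends k u w
    cyc         : Walk (odd k) (r α) (c β) vc dc
    closing     : α + δ ≡ β + odd k
    pth₁        : Walk (odd k) u (r x) vp dp
    pth₂        : Walk (odd k) (c x) w vq dq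
    vertices    : vc ++ vp ++ vq ↭ grid (odd k)
    differences : (δ ∷ dc) ++ dp ++ odd k ∷ dq ↭ deltas (odd k)
    cycLength   : length vc ≡ ℓ
    pthLength   : length vp + length vq ≡ suc m

close : ∀ {k x α β ℓ m} → Core k x α β ℓ m → Labeling k ℓ m
close C = record
  { ends = ends ; cyc = cyc ; closing = closing ; pth = pth₁ ▷⟨ refl ⟩ pth₂
  ; vertices = vertices ; differences = differences
  ; cycLength = cycLength ; pthLength = ≡.trans (length-++ vp) pthLength }
  where open Core C

length-seg : {A : Set} (f : ℕ → A) → ∀ a n → length (seg f a n) ≡ n
length-seg f a zero    = refl
length-seg f a (suc n) = cong suc (length-seg f (suc a) n)

length-grid : ∀ n → length (grid n) ≡ n + n
length-grid n = ≡.trans (length-++ (seg r 0 n)) (cong₂ _+_ (length-seg r 0 n) (length-seg c 0 n))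

length-map-grid : ∀ (f : V → V) n → length (map f (grid n)) ≡ n + n
length-map-grid f n = ≡.trans (length-map f (grid n)) (length-grid n)

Ends-shift : ∀ {k u w} s → Ends k u w → Ends (s + k) (sh s s u) (sh s s w)
Ends-shift s row-first = row-first
Ends-shift s col-first = col-first

-- A grid of size N in the middle of one of size N⁺ = s + N + s, with the upper right block
-- (rows from 0, columns from s + N) and the lower left block (rows from s + N, columns from 0).
-- The middle differences move to the middle, the upper block takes the s + s - 1 largest ones,
-- the lower block the s + s - 1 smallest; s + s and M + M are left for the edges between them.
module Frame (s′ k : ℕ) where

  s = suc s′
  N = odd k
  M = s + N
  N⁺ = odd (s + k)

  N⁺≡M+s : N⁺ ≡ M + s
  N⁺≡M+s = lemma s k
    where
    lemma : ∀ s k → suc (s + k + (s + k)) ≡ s + suc (k + k) + s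
    lemma = solve-∀

  N⁺≡2s+N : N⁺ ≡ s + s + N
  N⁺≡2s+N = lemma s k
    where
    lemma : ∀ s k → suc (s + k + (s + k)) ≡ s + s + suc (k + k)
    lemma = solve-∀

  inner : ∀ {u v vs ds} → Walk N u v vs ds → Walk N⁺ (sh s s u) (sh s s v) (map (sh s s) vs) (map (s + s +_) ds)
  inner = translate s s (s + s) (cong (s +_) (sym N⁺≡2s+N))

  upper : ∀ {u v} → Tile s u v → Walk N⁺ (sh 0 M u) (sh 0 M v) (map (sh 0 M) (grid s)) (map (M + M +_) (deltas s))
  upper = translate 0 M (M + M) (≡.trans (+-assoc M M s) (cong (M +_) (sym N⁺≡M+s)))

  lower : ∀ {u v} → Tile s u v → Walk N⁺ (sh M 0 u) (sh M 0 v) (map (sh M 0) (grid s)) (deltas s)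
  lower t = perm ↭-refl (↭-reflexive (map-id (deltas s))) (translate M 0 0 (sym N⁺≡M+s) t)

  open PermutationReasoning

  frame-vertices : map (sh s s) (grid N) ++ map (sh 0 M) (grid s) ++ map (sh M 0) (grid s) ↭ grid N⁺
  frame-vertices = begin
    map (sh s s) (grid N) ++ map (sh 0 M) (grid s) ++ map (sh M 0) (grid s)
      ≡⟨ cong₂ _++_ (map-sh-grid s s N) (cong₂ _++_ (map-sh-grid 0 M s) (map-sh-grid M 0 s)) ⟩
    (seg r s N ++ seg c s N) ++ (seg r 0 s ++ seg c M s) ++ (seg r M s ++ seg c 0 s)
      ↭⟨ solve 6 (λ r₁ c₁ r₀ c₂ r₂ c₀ → (r₁ ⊕ c₁) ⊕ (r₀ ⊕ c₂) ⊕ (r₂ ⊕ c₀) ⊜ (r₀ ⊕ r₁ ⊕ r₂) ⊕ (c₀ ⊕ c₁ ⊕ c₂)) ↭-refl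
           (seg r s N) (seg c s N) (seg r 0 s) (seg c M s) (seg r M s) (seg c 0 s) ⟩
    (seg r 0 s ++ seg r s N ++ seg r M s) ++ (seg c 0 s ++ seg c s N ++ seg c M s)
      ≡⟨ cong₂ _++_ (glue r) (glue c) ⟩
    grid N⁺ ∎
    where
    open Bag
    glue : (f : ℕ → V) → seg f 0 s ++ seg f s N ++ seg f M s ≡ seg f 0 N⁺
    glue f = ≡.trans (cong (seg f 0 s ++_) (seg-++ f s N refl refl))
                     (seg-++ f 0 s refl (≡.trans (sym (+-assoc s N s)) (sym N⁺≡M+s)))

  frame-deltas : map (s + s +_) (deltas N) ++ [ s + s ] ++ deltas s ++ [ M + M ] ++ map (M + M +_) (deltas s) ↭ deltas N⁺
  frame-deltas = begin
    map (s + s +_) (deltas N) ++ [ s + s ] ++ deltas s ++ [ M + M ] ++ map (M + M +_) (deltas s)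
      ↭⟨ solve 4 (λ x y z w → x ⊕ y ⊕ z ⊕ w ⊜ (z ⊕ y ⊕ x) ⊕ w) ↭-refl
           (map (s + s +_) (deltas N)) [ s + s ] (deltas s) ([ M + M ] ++ map (M + M +_) (deltas s)) ⟩
    (deltas s ++ [ s + s ] ++ map (s + s +_) (deltas N)) ++ [ M + M ] ++ map (M + M +_) (deltas s)
      ≡⟨ cong (_++ ([ M + M ] ++ map (M + M +_) (deltas s))) (deltas-join s′ (k + k)) ⟩
    deltas M ++ [ M + M ] ++ map (M + M +_) (deltas s)
      ≡⟨ deltas-join (s′ + N) s′ ⟩
    deltas (M + s)
      ≡⟨ cong deltas (sym N⁺≡M+s) ⟩
    deltas N⁺ ∎
    where open Bag

  module _ {x α β ℓ m} (C : Core k x α β ℓ m) where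
    open Core C

    inner-vertices : map (sh s s) vc ++ map (sh s s) vp ++ map (sh s s) vq ↭ map (sh s s) (grid N)
    inner-vertices = ↭-trans (↭-reflexive (sym (≡.trans (map-++ (sh s s) vc (vp ++ vq))
      (cong (map (sh s s) vc ++_) (map-++ (sh s s) vp vq))))) (map⁺ (sh s s) vertices)

    -- The main diagonal stays the main diagonal: its difference `N` is raised to `s + s + N`, which
    -- is `N⁺`.
    inner-deltas : map (s + s +_) (δ ∷ dc) ++ map (s + s +_) dp ++ [ N⁺ ] ++ map (s + s +_) dq ↭ map (s + s +_) (deltas N)
    inner-deltas = ↭-trans (↭-reflexive (sym (≡.trans (map-++ (s + s +_) (δ ∷ dc) (dp ++ N ∷ dq))
      (cong (map (s + s +_) (δ ∷ dc) ++_) (≡.trans (map-++ (s + s +_) dp (N ∷ dq))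
        (cong (λ z → map (s + s +_) dp ++ z ∷ map (s + s +_) dq) (sym N⁺≡2s+N)))))))
      (map⁺ (s + s +_) differences)

    inner-closing : s + α + (s + s + δ) ≡ s + β + N⁺
    inner-closing = Δ-shift s s (s + s) (cong (s +_) (sym N⁺≡2s+N)) (c β) (r α) closing

    frame-cover : ∀ {vs} → vs ↭ (map (sh s s) vc ++ map (sh s s) vp ++ map (sh s s) vq) ++ map (sh 0 M) (grid s) ++ map (sh M 0) (grid s) →
      vs ↭ grid N⁺
    frame-cover p = ↭-trans p (↭-trans (++⁺ʳ _ inner-vertices) frame-vertices)

    frame-differences : ∀ {ds} → ds ↭ (map (s + s +_) (δ ∷ dc) ++ map (s + s +_) dp ++ [ N⁺ ] ++ map (s + s +_) dq)
        ++ [ s + s ] ++ deltas s ++ [ M + M ] ++ map (M + M +_) (deltas s) →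
      ds ↭ deltas N⁺
    frame-differences p = ↭-trans p (↭-trans (++⁺ʳ _ inner-deltas) frame-deltas)

-- Because the upper path is the transpose of the lower one, it ends in row `i` just where the
-- reversed lower one begins in column `i`. So for any `i` the edge between them has the freed
-- difference `N⁺`, and the two links to the old path take `M + M` and `s + s`.
extend : ∀ {k x α β ℓ m} → ∀ q → Core k x α β ℓ m → Labeling (suc (x + q) + k) ℓ (4 * suc (x + q) + m)
extend {k} {x} {m = m} q C with abrham x q
... | i , A = record
  { ends        = Ends-shift s ends
  ; cyc         = inner cyc
  ; closing     = inner-closing C
  ; pth         = inner pth₁ ▷⟨ link₁ s x k ⟩ upper (transpose-Tile A) ▷⟨ refl ⟩ lower (reverse A) ▷⟨ link₂ s x k ⟩ inner pth₂
  ; vertices    = frame-cover C (solve 5 (λ vc vp vq u l → vc ⊕ vp ⊕ u ⊕ l ⊕ vq ⊜ (vc ⊕ vp ⊕ vq) ⊕ u ⊕ l) ↭-refl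
                    (map (sh s s) vc) (map (sh s s) vp) (map (sh s s) vq) (map (sh 0 M) (grid s)) (map (sh M 0) (grid s)))
  ; differences = frame-differences C (solve 8 (λ dc dp n dq a l b u → dc ⊕ dp ⊕ b ⊕ u ⊕ n ⊕ l ⊕ a ⊕ dq ⊜ (dc ⊕ dp ⊕ n ⊕ dq) ⊕ a ⊕ l ⊕ b ⊕ u) ↭-refl
                    (map (s + s +_) (δ ∷ dc)) (map (s + s +_) dp) [ N⁺ ] (map (s + s +_) dq)
                    [ s + s ] (deltas s) [ M + M ] (map (M + M +_) (deltas s)))
  ; cycLength   = ≡.trans (length-map (sh s s) vc) cycLength
  ; pthLength   = begin
      length (map (sh s s) vp ++ map (sh 0 M) (grid s) ++ map (sh M 0) (grid s) ++ map (sh s s) vq)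
        ≡⟨ ≡.trans (length-++ (map (sh s s) vp)) (cong₂ _+_ (length-map (sh s s) vp)
             (≡.trans (length-++ (map (sh 0 M) (grid s))) (cong₂ _+_ (length-map-grid (sh 0 M) s)
               (≡.trans (length-++ (map (sh M 0) (grid s))) (cong₂ _+_ (length-map-grid (sh M 0) s) (length-map (sh s s) vq)))))) ⟩
      length vp + (s + s + (s + s + length vq))
        ≡⟨ regroup s (length vp) (length vq) ⟩
      4 * s + (length vp + length vq)
        ≡⟨ cong (4 * s +_) pthLength ⟩
      4 * s + suc m
        ≡⟨ +-suc (4 * s) m ⟩
      suc (4 * s + m) ∎
  }
  where
  open Core C
  open Frame (x + q) k
  open Bag
  open ≡-Reasoning
  link₁ : ∀ s x k → s + x + (s + suc (k + k) + (s + suc (k + k))) ≡ s + suc (k + k) + x + suc (s + k + (s + k))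
  link₁ = solve-∀
  link₂ : ∀ s x k → s + suc (k + k) + x + (s + s) ≡ s + x + suc (s + k + (s + k))
  link₂ = solve-∀
  regroup : ∀ s a b → a + (s + s + (s + s + b)) ≡ 4 * s + (a + b)
  regroup = solve-∀

-- The closing edge of the cycle is on diagonal -g, at the lower right corner of the grid.
Growable : ℕ → ℕ → ℕ → ℕ → ℕ → Set
Growable g k x ℓ m = ∃ λ α → ∃ λ β → α ≡ k + k × β + g ≡ k + k × Core k x α β ℓ m

-- The cycle is opened at its closing edge and continued by a zigzag in each block; block size
-- `g + 1` is what makes the links take `s + s` and `M + M`. The new closing edge takes over the
-- difference of the old one and lies again in the last row on diagonal `-g`, so the step can be
-- repeated.
grow : ∀ {g k x ℓ m} → Growable g k x ℓ m → Growable g (suc g + k) (suc g + x) (4 * suc g + ℓ) m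
grow {g} {k} {x} {ℓ} (α , β , refl , β+g , C) = M + g , M + 0 , start g k , end g k , record
  { ends        = Ends-shift s ends
  ; cyc         = lower (hiZigzag g) ▷⟨ link₁ g k ⟩ inner cyc ▷⟨ link₂ ⟩ upper (loZigzag g)
  ; closing     = closing⁺
  ; pth₁        = inner pth₁
  ; pth₂        = inner pth₂
  ; vertices    = frame-cover C (solve 5 (λ vc vp vq u l → (l ⊕ vc ⊕ u) ⊕ vp ⊕ vq ⊜ (vc ⊕ vp ⊕ vq) ⊕ u ⊕ l) ↭-refl
                    (map (sh s s) vc) (map (sh s s) vp) (map (sh s s) vq) (map (sh 0 M) (grid s)) (map (sh M 0) (grid s)))
  ; differences = frame-differences C (solve 9 (λ d dc dp n dq a l b u → (d ⊕ l ⊕ a ⊕ dc ⊕ b ⊕ u) ⊕ dp ⊕ n ⊕ dq ⊜ ((d ⊕ dc) ⊕ dp ⊕ n ⊕ dq) ⊕ a ⊕ l ⊕ b ⊕ u) ↭-refl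
                    [ s + s + δ ] (map (s + s +_) dc) (map (s + s +_) dp) [ N⁺ ] (map (s + s +_) dq)
                    [ s + s ] (deltas s) [ M + M ] (map (M + M +_) (deltas s)))
  ; cycLength   = begin
      length (map (sh M 0) (grid s) ++ map (sh s s) vc ++ map (sh 0 M) (grid s))
        ≡⟨ ≡.trans (length-++ (map (sh M 0) (grid s))) (cong₂ _+_ (length-map-grid (sh M 0) s)
             (≡.trans (length-++ (map (sh s s) vc)) (cong₂ _+_ (≡.trans (length-map (sh s s) vc) cycLength) (length-map-grid (sh 0 M) s)))) ⟩
      s + s + (ℓ + (s + s))
        ≡⟨ regroup s ℓ ⟩
      4 * s + ℓ ∎
  ; pthLength   = ≡.trans (cong₂ _+_ (length-map (sh s s) vp) (length-map (sh s s) vq)) pthLength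
  }
  where
  open Core C
  open Frame g k
  open Bag
  open ≡-Reasoning
  start : ∀ g k → suc g + suc (k + k) + g ≡ suc g + k + (suc g + k)
  start = solve-∀
  end : ∀ g k → suc g + suc (k + k) + 0 + g ≡ suc g + k + (suc g + k)
  end = solve-∀
  link₁ : ∀ g k → suc g + (k + k) + (suc g + suc g) ≡ g + suc (suc g + k + (suc g + k))
  link₁ = solve-∀
  regroup : ∀ s ℓ → s + s + (ℓ + (s + s)) ≡ 4 * s + ℓ
  regroup = solve-∀
  link₂ : M + M ≡ s + β + N⁺
  link₂ = begin
    s + N + (s + suc (k + k))   ≡⟨ cong (λ z → s + N + (s + suc z)) (sym β+g) ⟩
    s + N + (s + suc (β + g))   ≡⟨ lemma g N β ⟩
    s + β + (s + s + N)         ≡⟨ cong (s + β +_) (sym N⁺≡2s+N) ⟩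
    s + β + N⁺ ∎
    where
    lemma : ∀ g N β → suc g + N + (suc g + suc (β + g)) ≡ suc g + β + (suc g + suc g + N)
    lemma = solve-∀
  g+δ : g + δ ≡ N
  g+δ = +-cancelˡ-≡ β _ _ (≡.trans (sym (+-assoc β g δ)) (≡.trans (cong (_+ δ) β+g) closing))
  closing⁺ : M + g + (s + s + δ) ≡ M + 0 + N⁺
  closing⁺ = begin
    M + g + (s + s + δ)         ≡⟨ lemma M g s δ ⟩
    M + 0 + (s + s + (g + δ))   ≡⟨ cong (λ z → M + 0 + (s + s + z)) g+δ ⟩
    M + 0 + (s + s + N)         ≡⟨ cong (M + 0 +_) (sym N⁺≡2s+N) ⟩
    M + 0 + N⁺ ∎
    where
    lemma : ∀ M g s δ → M + g + (s + s + δ) ≡ M + 0 + (s + s + (g + δ))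
    lemma = solve-∀

-- Initial cases

module _ {A : Set} (_≟_ : DecidableEquality A) where

  extract : ∀ x ys → Maybe (∃ λ zs → x ∷ zs ↭ ys)
  extract x []       = nothing
  extract x (y ∷ ys) with x ≟ y
  ... | yes refl = just (ys , ↭-refl)
  ... | no _     with extract x ys
  ...   | nothing       = nothing
  ...   | just (zs , p) = just (y ∷ zs , trans (swap x y ↭-refl) (prep y p))

  permute : ∀ xs ys → Maybe (xs ↭ ys)
  permute [] []      = just ↭-refl
  permute [] (_ ∷ _) = nothing
  permute (x ∷ xs) ys with extract x ys
  ... | nothing       = nothing
  ... | just (zs , p) with permute xs zs
  ...   | nothing = nothing
  ...   | just q  = just (trans (prep x q) p)

_≟ⱽ_ : DecidableEquality V
r a ≟ⱽ r b = map′ (cong r) (λ where refl → refl) (a ≟ b)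
c a ≟ⱽ c b = map′ (cong c) (λ where refl → refl) (a ≟ b)
r _ ≟ⱽ c _ = no λ ()
c _ ≟ⱽ r _ = no λ ()

-- Both covering conditions are verified by evaluation: once `permute` succeeds, the implicit
-- arguments are trivially inhabited.
small : ∀ {k x α β m u w δ vc vp vq dc dp dq} → Ends k u w → α + δ ≡ β + odd k → length vp + length vq ≡ suc m →
  Walk (odd k) (r α) (c β) vc dc → Walk (odd k) u (r x) vp dp → Walk (odd k) (c x) w vq dq →
  {_ : T (is-just (permute _≟ⱽ_ (vc ++ vp ++ vq) (grid (odd k))))} →
  {_ : T (is-just (permute _≟_ ((δ ∷ dc) ++ dp ++ odd k ∷ dq) (deltas (odd k))))} →
  Core k x α β (length vc) m
small ends closing pthLength cyc pth₁ pth₂ {tv} {td} = record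
  { ends = ends ; closing = closing ; cyc = cyc ; pth₁ = pth₁ ; pth₂ = pth₂
  ; vertices = to-witness-T _ tv ; differences = to-witness-T _ td
  ; cycLength = refl ; pthLength = pthLength }

-- The path is the single edge `r k` to `c k`, so `x = k`. With `g = 1` growing adds 2 to `k` and 8
-- to the cycle, hence two starting cases.
cores-m≡1 : ∀ t → Growable 1 (2 + t) (2 + t) (8 + t * 4) 1
cores-m≡1 0 = _ , _ , refl , refl , small row-first refl refl
    (r 4 —⟨ refl ⟩ c 0 —⟨ refl ⟩ r 3 —⟨ refl ⟩ c 1 —⟨ refl ⟩ r 0 —⟨ refl ⟩ c 4 —⟨ refl ⟩
     r 1 —⟨ refl ⟩ ⟨ c 3 ⟩)
    ⟨ r 2 ⟩
    ⟨ c 2 ⟩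
cores-m≡1 1 = _ , _ , refl , refl , small row-first refl refl
    (r 6 —⟨ refl ⟩ c 0 —⟨ refl ⟩ r 5 —⟨ refl ⟩ c 1 —⟨ refl ⟩ r 4 —⟨ refl ⟩ c 2 —⟨ refl ⟩
     r 1 —⟨ refl ⟩ c 4 —⟨ refl ⟩ r 2 —⟨ refl ⟩ c 6 —⟨ refl ⟩ r 0 —⟨ refl ⟩ ⟨ c 5 ⟩)
    ⟨ r 3 ⟩
    ⟨ c 3 ⟩
cores-m≡1 (suc (suc t)) = grow (cores-m≡1 t)

-- The cores below were found by computer search.
core-[10∣3] : Core 3 2 6 4 10 3
core-[10∣3] = small col-first refl refl
    (r 6 —⟨ refl ⟩ c 0 —⟨ refl ⟩ r 5 —⟨ refl ⟩ c 1 —⟨ refl ⟩ r 4 —⟨ refl ⟩ c 6 —⟨ refl ⟩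
     r 0 —⟨ refl ⟩ c 5 —⟨ refl ⟩ r 1 —⟨ refl ⟩ ⟨ c 4 ⟩)
    (c 3 —⟨ refl ⟩ ⟨ r 2 ⟩)
    (c 2 —⟨ refl ⟩ ⟨ r 3 ⟩)

core-[14∣3] : Core 4 3 8 6 14 3
core-[14∣3] = small col-first refl refl
    (r 8 —⟨ refl ⟩ c 0 —⟨ refl ⟩ r 7 —⟨ refl ⟩ c 1 —⟨ refl ⟩ r 6 —⟨ refl ⟩ c 2 —⟨ refl ⟩
     r 5 —⟨ refl ⟩ c 7 —⟨ refl ⟩ r 0 —⟨ refl ⟩ c 8 —⟨ refl ⟩ r 2 —⟨ refl ⟩ c 5 —⟨ refl ⟩
     r 1 —⟨ refl ⟩ ⟨ c 6 ⟩)
    (c 4 —⟨ refl ⟩ ⟨ r 3 ⟩)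
    (c 3 —⟨ refl ⟩ ⟨ r 4 ⟩)

core-[18∣3] : Core 5 4 9 7 18 3
core-[18∣3] = small col-first refl refl
    (r 9 —⟨ refl ⟩ c 0 —⟨ refl ⟩ r 10 —⟨ refl ⟩ c 2 —⟨ refl ⟩ r 6 —⟨ refl ⟩ c 3 —⟨ refl ⟩
     r 8 —⟨ refl ⟩ c 1 —⟨ refl ⟩ r 7 —⟨ refl ⟩ c 9 —⟨ refl ⟩ r 0 —⟨ refl ⟩ c 10 —⟨ refl ⟩
     r 2 —⟨ refl ⟩ c 6 —⟨ refl ⟩ r 3 —⟨ refl ⟩ c 8 —⟨ refl ⟩ r 1 —⟨ refl ⟩ ⟨ c 7 ⟩)
    (c 5 —⟨ refl ⟩ ⟨ r 4 ⟩)
    (c 4 —⟨ refl ⟩ ⟨ r 5 ⟩)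

core-[30∣3] : Core 8 7 16 14 30 3
core-[30∣3] = small col-first refl refl
    (r 16 —⟨ refl ⟩ c 0 —⟨ refl ⟩ r 15 —⟨ refl ⟩ c 1 —⟨ refl ⟩ r 14 —⟨ refl ⟩ c 2 —⟨ refl ⟩
     r 13 —⟨ refl ⟩ c 3 —⟨ refl ⟩ r 12 —⟨ refl ⟩ c 4 —⟨ refl ⟩ r 11 —⟨ refl ⟩ c 5 —⟨ refl ⟩
     r 10 —⟨ refl ⟩ c 6 —⟨ refl ⟩ r 9 —⟨ refl ⟩ c 11 —⟨ refl ⟩ r 3 —⟨ refl ⟩ c 12 —⟨ refl ⟩
     r 2 —⟨ refl ⟩ c 13 —⟨ refl ⟩ r 6 —⟨ refl ⟩ c 9 —⟨ refl ⟩ r 5 —⟨ refl ⟩ c 10 —⟨ refl ⟩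
     r 4 —⟨ refl ⟩ c 16 —⟨ refl ⟩ r 0 —⟨ refl ⟩ c 15 —⟨ refl ⟩ r 1 —⟨ refl ⟩ ⟨ c 14 ⟩)
    (c 8 —⟨ refl ⟩ ⟨ r 7 ⟩)
    (c 7 —⟨ refl ⟩ ⟨ r 8 ⟩)

core-[4∣9] : Core 3 1 0 6 4 9
core-[4∣9] = small col-first refl refl
    (r 0 —⟨ refl ⟩ c 5 —⟨ refl ⟩ r 2 —⟨ refl ⟩ ⟨ c 6 ⟩)
    (c 3 —⟨ refl ⟩ ⟨ r 1 ⟩)
    (c 1 —⟨ refl ⟩ r 4 —⟨ refl ⟩ c 2 —⟨ refl ⟩ r 6 —⟨ refl ⟩ c 0 —⟨ refl ⟩ r 5 —⟨ refl ⟩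
     c 4 —⟨ refl ⟩ ⟨ r 3 ⟩)

core-[4∣13] : Core 4 1 2 7 4 13
core-[4∣13] = small row-first refl refl
    (r 2 —⟨ refl ⟩ c 5 —⟨ refl ⟩ r 3 —⟨ refl ⟩ ⟨ c 7 ⟩)
    (r 4 —⟨ refl ⟩ c 3 —⟨ refl ⟩ r 5 —⟨ refl ⟩ c 6 —⟨ refl ⟩ r 0 —⟨ refl ⟩ c 8 —⟨ refl ⟩ ⟨ r 1 ⟩)
    (c 1 —⟨ refl ⟩ r 6 —⟨ refl ⟩ c 2 —⟨ refl ⟩ r 8 —⟨ refl ⟩ c 0 —⟨ refl ⟩ r 7 —⟨ refl ⟩ ⟨ c 4 ⟩)

core-[6∣11] : Core 4 1 0 8 6 11
core-[6∣11] = small row-first refl refl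
    (r 0 —⟨ refl ⟩ c 7 —⟨ refl ⟩ r 3 —⟨ refl ⟩ c 5 —⟨ refl ⟩ r 2 —⟨ refl ⟩ ⟨ c 8 ⟩)
    (r 4 —⟨ refl ⟩ c 3 —⟨ refl ⟩ r 5 —⟨ refl ⟩ c 6 —⟨ refl ⟩ ⟨ r 1 ⟩)
    (c 1 —⟨ refl ⟩ r 6 —⟨ refl ⟩ c 2 —⟨ refl ⟩ r 8 —⟨ refl ⟩ c 0 —⟨ refl ⟩ r 7 —⟨ refl ⟩ ⟨ c 4 ⟩)

core-[6∣15] : Core 5 6 7 3 6 15
core-[6∣15] = small col-first refl refl
    (r 7 —⟨ refl ⟩ c 2 —⟨ refl ⟩ r 3 —⟨ refl ⟩ c 8 —⟨ refl ⟩ r 2 —⟨ refl ⟩ ⟨ c 3 ⟩)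
    (c 5 —⟨ refl ⟩ r 8 —⟨ refl ⟩ c 1 —⟨ refl ⟩ r 9 —⟨ refl ⟩ c 0 —⟨ refl ⟩ r 10 —⟨ refl ⟩
     c 4 —⟨ refl ⟩ ⟨ r 6 ⟩)
    (c 6 —⟨ refl ⟩ r 4 —⟨ refl ⟩ c 7 —⟨ refl ⟩ r 0 —⟨ refl ⟩ c 10 —⟨ refl ⟩ r 1 —⟨ refl ⟩
     c 9 —⟨ refl ⟩ ⟨ r 5 ⟩)

-- The core of [18 | 3] is not growable, so the recursion with step 3 starts at k = 6.
cores-m≡3-growable : ∀ t → Growable 2 (6 + t) (5 + t) (22 + t * 4) 3
cores-m≡3-growable 0 = grow (_ , _ , refl , refl , core-[10∣3])
cores-m≡3-growable 1 = grow (_ , _ , refl , refl , core-[14∣3])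
cores-m≡3-growable 2 = _ , _ , refl , refl , core-[30∣3]
cores-m≡3-growable (suc (suc (suc t))) = grow (cores-m≡3-growable t)

-- The path is `c k`, `r (k - 1)`, `c (k - 1)`, `r k`, with its middle edge on the main diagonal.
-- Not asking for growability lets [18 | 3] in.
cores-m≡3 : ∀ t → ∃ λ α → ∃ λ β → Core (3 + t) (2 + t) α β (10 + t * 4) 3
cores-m≡3 0 = _ , _ , core-[10∣3]
cores-m≡3 1 = _ , _ , core-[14∣3]
cores-m≡3 2 = _ , _ , core-[18∣3]
cores-m≡3 (suc (suc (suc t))) with cores-m≡3-growable t
... | α , β , _ , _ , C = α , β , C

-- Labelings as lists of labels

-- `Walk` without `perm`: the indices follow the order of the path, as `pathEdges` needs.
data Trail (N : ℕ) : V → V → List V → List ℕ → Set where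
  ⟨_⟩  : ∀ v → Trail N v v [ v ] []
  step : ∀ {u v w δ vs ds} → Δ N u v δ → Trail N v w vs ds → Trail N u w (u ∷ vs) (δ ∷ ds)

trail : ∀ {N u w vs ds} → Walk N u w vs ds → ∃ λ us → ∃ λ es → Trail N u w us es × us ↭ vs × es ↭ ds
trail ⟨ v ⟩ = _ , _ , ⟨ v ⟩ , ↭-refl , ↭-refl
trail (step e t) with trail t
... | us , es , t′ , p , q = _ , _ , step e t′ , prep _ p , prep _ q
trail (perm p q t) with trail t
... | us , es , t′ , p′ , q′ = us , es , t′ , ↭-trans p′ p , ↭-trans q′ q

_◁_ : ∀ {N u v w us es δ} → Trail N u v us es → Δ N v w δ → Trail N u w (us ++ [ w ]) (es ++ [ δ ])
⟨ v ⟩     ◁ e = step e ⟨ _ ⟩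
step f t  ◁ e = step f (t ◁ e)

label : ℕ → V → ℕ
label N (r a) = a
label N (c b) = N + b

labels : ℕ → List V → List ℕ
labels N = map (label N)

± : ℕ → List ℤ
± δ = pos δ ∷ - pos δ ∷ []

concatMap-↭ : {A B : Set} (f : A → List B) {xs ys : List A} → xs ↭ ys → concatMap f xs ↭ concatMap f ys
concatMap-↭ f refl         = ↭-refl
concatMap-↭ f (prep x p)   = ++⁺ˡ (f x) (concatMap-↭ f p)
concatMap-↭ f (swap x y p) = trans (shifts (f x) (f y)) (++⁺ˡ (f y) (++⁺ˡ (f x) (concatMap-↭ f p)))
concatMap-↭ f (trans p q)  = trans (concatMap-↭ f p) (concatMap-↭ f q)

-- The column label exceeds the row label by `δ`, so the order of the two signs depends on the
-- direction of the edge.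
label-differences : ∀ {N} u v {δ zs} → Δ N u v δ →
  (pos (label N u) -ℤ pos (label N v)) ∷ (pos (label N v) -ℤ pos (label N u)) ∷ zs ↭ ± δ ++ zs
label-differences {N} = go
  where
  up : ∀ a δ → a +ℤ δ -ℤ a ≡ δ
  up = ℤ-solve-∀
  down : ∀ a δ → a -ℤ (a +ℤ δ) ≡ - δ
  down = ℤ-solve-∀
  below : ∀ a b {δ} → a + δ ≡ b + N → pos (N + b) ≡ pos a +ℤ pos δ
  below a b p = cong pos (≡.trans (+-comm N b) (sym p))
  upper : ∀ a b {δ} → a + δ ≡ b + N → pos (N + b) -ℤ pos a ≡ pos δ
  upper a b {δ} p = ≡.trans (cong (_-ℤ pos a) (below a b p)) (up (pos a) (pos δ))
  lower : ∀ a b {δ} → a + δ ≡ b + N → pos a -ℤ pos (N + b) ≡ - pos δ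
  lower a b {δ} p = ≡.trans (cong (pos a -ℤ_) (below a b p)) (down (pos a) (pos δ))
  go : ∀ u v {δ zs} → Δ N u v δ → (pos (label N u) -ℤ pos (label N v)) ∷ (pos (label N v) -ℤ pos (label N u)) ∷ zs ↭ ± δ ++ zs
  go (r a) (c b) p = trans (↭-reflexive (cong₂ (λ x y → x ∷ y ∷ _) (lower a b p) (upper a b p))) (swap _ _ ↭-refl)
  go (c b) (r a) p = ↭-reflexive (cong₂ (λ x y → x ∷ y ∷ _) (upper a b p) (lower a b p))

ΔΓ-trail : ∀ {N u w us es} → Trail N u w us es → ΔΓ (pathEdges (labels N us)) ↭ concatMap ± es
ΔΓ-trail ⟨ v ⟩                              = ↭-refl
-- The tail is matched only to expose its first vertex, so that `pathEdges` computes.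
ΔΓ-trail (step {u} {v} e t@(⟨ _ ⟩))         = trans (label-differences u v e) (++⁺ˡ (± _) (ΔΓ-trail t))
ΔΓ-trail (step {u} {v} e t@(step _ _))      = trans (label-differences u v e) (++⁺ˡ (± _) (ΔΓ-trail t))

Inside : ℕ → V → Set
Inside n (r a) = a < n
Inside n (c b) = b < n

seg-upTo : {A : Set} (f g : ℕ → A) → ∀ a n → (∀ i → f (a + i) ≡ g i) → seg f a n ≡ applyUpTo g n
seg-upTo f g a zero    h = refl
seg-upTo f g a (suc n) h = cong₂ _∷_ (≡.trans (cong f (sym (+-identityʳ a))) (h 0))
  (seg-upTo f (g ∘ suc) (suc a) n (λ i → ≡.trans (cong f (sym (+-suc a i))) (h (suc i))))

grid-Inside : ∀ n → All (Inside n) (grid n)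
grid-Inside n = AllP.++⁺
  (subst (All (Inside n)) (sym (seg-upTo r r 0 n (λ _ → refl))) (AllP.applyUpTo⁺₁ r n id))
  (subst (All (Inside n)) (sym (seg-upTo c c 0 n (λ _ → refl))) (AllP.applyUpTo⁺₁ c n id))

grid-labels : ∀ N → labels N (grid N) ≡ upTo (N + N)
grid-labels N = begin
  labels N (seg r 0 N ++ seg c 0 N)     ≡⟨ map-++ (label N) (seg r 0 N) (seg c 0 N) ⟩
  labels N (seg r 0 N) ++ labels N (seg c 0 N)
    ≡⟨ cong₂ _++_ (seg-map 0 (λ _ → refl) 0 N) (seg-map N (λ _ → refl) 0 N) ⟩
  seg id 0 N ++ seg id (N + 0) N        ≡⟨ seg-++ id 0 N (sym (+-identityʳ N)) refl ⟩
  seg id 0 (N + N)                      ≡⟨ seg-upTo id id 0 (N + N) (λ _ → refl) ⟩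
  upTo (N + N) ∎
  where open ≡-Reasoning

deltas-±I1 : ∀ k → concatMap ± (deltas (odd k)) ≡ ±I1 (k + k + odd k)
deltas-±I1 k = begin
  concatMap ± (seg id 1 n)        ≡⟨ cong (concatMap ±) (seg-upTo id suc 1 n (λ _ → refl)) ⟩
  concatMap ± (applyUpTo suc n)   ≡⟨ cong (concatMap ±) (sym (map-upTo suc n)) ⟩
  concatMap ± (map suc (upTo n))  ≡⟨ concatMap-map ± suc (upTo n) ⟩
  ±I1 n ∎
  where
  open ≡-Reasoning
  n = k + k + odd k

module _ (k : ℕ) where

  private
    N = odd k
    ε = k + k + odd k

  -- As `ε = 4k + 1`, the two halves of an α-labeling are separated between `k + k` and `N`, exactly
  -- where rows end and columns begin.
  half-below : (ε ∸ 1) / 2 ≡ k + k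
  half-below = ≡.trans (cong (_/ 2) (≡.trans (cong (_∸ 1) (+-suc (k + k) (k + k))) (twice k))) (m*n/n≡m (k + k) 2)
    where
    twice : ∀ k → k + k + (k + k) ≡ (k + k) * 2
    twice = solve-∀

  half-above : (ε + 1) / 2 ≡ N
  half-above = ≡.trans (cong (_/ 2) (twice k)) (m*n/n≡m N 2)
    where
    twice : ∀ k → k + k + suc (k + k) + 1 ≡ suc (k + k) * 2
    twice = solve-∀

  low : ∀ {a} → a < N → a ≤ (ε ∸ 1) / 2
  low a<N = ≤-trans (≤-pred a<N) (≤-reflexive (sym half-below))

  high : ∀ b → (ε + 1) / 2 ≤ N + b
  high b = ≤-trans (≤-reflexive half-above) (m≤m+n N b)

  top : ∀ {b} → b < N → N + b ≤ ε
  top b<N = ≤-trans (+-monoʳ-≤ N (≤-pred b<N)) (≤-reflexive (+-comm N (k + k)))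

  crossing : ∀ u v {δ} → Inside N u → Inside N v → Δ N u v δ → Crossing ε (label N u , label N v)
  crossing (r a) (c b) a<N b<N _ = inj₁ (low a<N , high b , top b<N)
  crossing (c b) (r a) b<N a<N _ = inj₂ (low a<N , high b , top b<N)

  pathEdges-crossing : ∀ {u w us es} → Trail N u w us es → All (Inside N) us → All (Crossing ε) (pathEdges (labels N us))
  pathEdges-crossing ⟨ v ⟩ _ = []
  pathEdges-crossing (step {u} {v} e t@(⟨ _ ⟩))    (i ∷ is@(j ∷ _)) = crossing u v i j e ∷ pathEdges-crossing t is
  pathEdges-crossing (step {u} {v} e t@(step _ _)) (i ∷ is@(j ∷ _)) = crossing u v i j e ∷ pathEdges-crossing t is

-- A cycle becomes a path that repeats its first vertex, so the lemmas on trails apply to it.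
cycleEdges-closed : ∀ {N u w us es} → Trail N u w us es → cycleEdges (labels N us) ≡ pathEdges (labels N (us ++ [ u ]))
cycleEdges-closed ⟨ v ⟩                = refl
cycleEdges-closed {N} {u} (step {vs = us} _ _) = cong (λ z → pathEdges (label N u ∷ z)) (sym (map-++ (label N) us [ u ]))

Trail-head : ∀ {N u w us es} → Trail N u w us es → head (labels N us) ≡ just (label N u)
Trail-head ⟨ v ⟩      = refl
Trail-head (step _ _) = refl

Trail-last : ∀ {N u w us es} → Trail N u w us es → last (labels N us) ≡ just (label N w)
Trail-last ⟨ v ⟩                = refl
Trail-last (step _ t@(⟨ _ ⟩))   = Trail-last t
Trail-last (step _ t@(step _ _)) = Trail-last t

module _ {k ℓ m : ℕ} (L : Labeling k ℓ m) where
  open Labeling L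

  -- Counting vertices against the grid determines `k` from `ℓ + m`, which is why `k` can be left
  -- existential in `Labelable`.
  Labeling-size : ℓ + m ≡ k + k + odd k
  Labeling-size = suc-injective (begin
    suc (ℓ + m)             ≡⟨ sym (+-suc ℓ m) ⟩
    ℓ + suc m               ≡⟨ cong₂ _+_ (sym cycLength) (sym pthLength) ⟩
    length vc + length vp   ≡⟨ sym (length-++ vc) ⟩
    length (vc ++ vp)       ≡⟨ ↭-length vertices ⟩
    length (grid (odd k))   ≡⟨ length-grid (odd k) ⟩
    odd k + odd k ∎)
    where open ≡-Reasoning

  Labeling⇒IsAL : ∃ λ cyc → ∃ λ pth → IsAL ℓ m k (3 * k + 1) cyc pth
  Labeling⇒IsAL with trail cyc | trail pth
  ... | us , es , s , us↭vc , es↭dc | ws , fs , t , ws↭vp , fs↭dp = labels N us , labels N ws , record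
    { cycLength = ≡.trans (length-map (label N) us) (≡.trans (↭-length us↭vc) cycLength)
    ; pthLength = ≡.trans (length-map (label N) ws) (≡.trans (↭-length ws↭vp) pthLength)
    -- Distinctness and the vertex set both come from the labels being a permutation of 0 ... ε.
    ; distinct  = PermutationSetoid.Unique-resp-↭ (setoid ℕ) (↭⇒↭ₛ (↭-sym labels↭)) (upTo⁺ (N + N))
    ; vertexSet = λ z → mk⇔
        (λ z∈ → subst (z ≤_) (sym Labeling-size) (≤-pred (∈-upTo⁻ (∈-resp-↭ labels↭ z∈))))
        (λ z≤ → ∈-resp-↭ (↭-sym labels↭) (∈-upTo⁺ (s≤s (subst (z ≤_) Labeling-size z≤))))
    ; bipartite = subst (λ ε → All (Crossing ε) (edges (labels N us) (labels N ws))) (sym Labeling-size)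
        (AllP.++⁺ (subst (All _) (sym cycle≡) (pathEdges-crossing k closed (AllP.++⁺ us-inside (start-inside s us-inside ∷ []))))
                  (pathEdges-crossing k t ws-inside))
    ; ends      = labelled ends (Trail-head t) (Trail-last t)
    ; labeling  = edges↭
    }
    where
    N = odd k
    closed = s ◁ closing
    cycle≡ = cycleEdges-closed s
    us++ws↭grid : us ++ ws ↭ grid N
    us++ws↭grid = trans (++⁺ us↭vc ws↭vp) vertices
    inside : All (Inside N) (us ++ ws)
    inside = All-resp-↭ (↭-sym us++ws↭grid) (grid-Inside N)
    us-inside : All (Inside N) us
    us-inside = AllP.++⁻ˡ us inside
    ws-inside : All (Inside N) ws
    ws-inside = AllP.++⁻ʳ us inside
    start-inside : ∀ {u w us es} → Trail N u w us es → All (Inside N) us → Inside N u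
    start-inside ⟨ _ ⟩      (i ∷ _) = i
    start-inside (step _ _) (i ∷ _) = i
    labels↭ : labels N us ++ labels N ws ↭ upTo (N + N)
    labels↭ = trans (↭-reflexive (sym (map-++ (label N) us ws)))
      (trans (map⁺ (label N) us++ws↭grid) (↭-reflexive (grid-labels N)))
    N+k : ∀ k → suc (k + k) + k ≡ 3 * k + 1
    N+k = solve-∀
    labelled : ∀ {u w} → Ends k u w → head (labels N ws) ≡ just (label N u) → last (labels N ws) ≡ just (label N w) →
      (head (labels N ws) ≡ just k × last (labels N ws) ≡ just (3 * k + 1)) ⊎
      (head (labels N ws) ≡ just (3 * k + 1) × last (labels N ws) ≡ just k)
    labelled row-first h l = inj₁ (h , ≡.trans l (cong just (N+k k)))
    labelled col-first h l = inj₂ (≡.trans h (cong just (N+k k)) , l)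
    edges↭ : ΔΓ (edges (labels N us) (labels N ws)) ↭ ±I1 (ℓ + m)
    edges↭ = begin
      ΔΓ (edges (labels N us) (labels N ws))
        ≡⟨ concatMap-++ _ (cycleEdges (labels N us)) (pathEdges (labels N ws)) ⟩
      ΔΓ (cycleEdges (labels N us)) ++ ΔΓ (pathEdges (labels N ws))
        ≡⟨ cong (λ es → ΔΓ es ++ ΔΓ (pathEdges (labels N ws))) cycle≡ ⟩
      ΔΓ (pathEdges (labels N (us ++ _))) ++ ΔΓ (pathEdges (labels N ws))
        ↭⟨ ++⁺ (ΔΓ-trail closed) (ΔΓ-trail t) ⟩
      concatMap ± (es ++ [ δ ]) ++ concatMap ± fs
        ≡⟨ sym (concatMap-++ ± (es ++ [ δ ]) fs) ⟩
      concatMap ± ((es ++ [ δ ]) ++ fs)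
        ↭⟨ concatMap-↭ ± (++⁺ (trans (++-comm es [ δ ]) (prep δ es↭dc)) fs↭dp) ⟩
      concatMap ± ((δ ∷ dc) ++ dp)
        ↭⟨ concatMap-↭ ± differences ⟩
      concatMap ± (deltas N)
        ≡⟨ ≡.trans (deltas-±I1 k) (cong ±I1 (sym Labeling-size)) ⟩
      ±I1 (ℓ + m) ∎
      where open PermutationReasoning

-- The pairs of lengths in the theorem

Labelable : ℕ → ℕ → Set
Labelable ℓ m = ∃ λ k → Labeling k ℓ m

halve : ∀ n → ∃ λ t → n ≡ t + t ⊎ n ≡ suc (t + t)
halve zero = 0 , inj₁ refl
halve (suc n) with halve n
... | t , inj₁ refl = t , inj₂ refl
... | t , inj₂ refl = suc t , inj₁ (cong suc (sym (+-suc t t)))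

path-1 : ∀ t → Labelable (8 + t * 4) 1
path-1 t with cores-m≡1 t
... | _ , _ , _ , _ , C = _ , close C

path-3 : ∀ t → Labelable (10 + t * 4) 3
path-3 t with cores-m≡3 t
... | _ , _ , C = _ , close C

-- For cycle length at least 8 the cores of [ℓ | 1] and [ℓ | 3] have `x = 2 + t`; the least block
-- size `3 + t` gives exactly `m = ℓ + 5`. The cores of [4 | 9] and [6 | 11] have `x = 1` and need
-- blocks of size at least 2, so `q = 1` is supplied separately.
long-path : ∀ p q → Labelable (4 + p * 2) (4 + p * 2 + 5 + q * 4)
long-path 0 0             = _ , close core-[4∣9]
long-path 0 1             = _ , close core-[4∣13]
long-path 0 (suc (suc q)) = _ , subst (Labeling _ 4) (eq q) (extend q core-[4∣9])
  where
  eq : ∀ q → 4 * suc (1 + q) + 9 ≡ 9 + suc (suc q) * 4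
  eq = solve-∀
long-path 1 0             = _ , close core-[6∣11]
long-path 1 1             = _ , close core-[6∣15]
long-path 1 (suc (suc q)) = _ , subst (Labeling _ 6) (eq q) (extend q core-[6∣11])
  where
  eq : ∀ q → 4 * suc (1 + q) + 11 ≡ 11 + suc (suc q) * 4
  eq = solve-∀
-- The cycle length is `8 + p * 2`; the parity of `p` decides it modulo 4 and thereby whether the
-- path starts from length 1 or 3.
long-path (suc (suc p)) q with halve p
... | t , inj₁ refl with cores-m≡1 t
...   | _ , _ , _ , _ , C = _ , subst₂ (Labeling _) (ℓ≡ t) (m≡ t q) (extend q C)
  where
  ℓ≡ : ∀ t → 8 + t * 4 ≡ 4 + suc (suc (t + t)) * 2
  ℓ≡ = solve-∀
  m≡ : ∀ t q → 4 * suc (2 + t + q) + 1 ≡ 4 + suc (suc (t + t)) * 2 + 5 + q * 4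
  m≡ = solve-∀
long-path (suc (suc p)) q | t , inj₂ refl with cores-m≡3 t
...   | _ , _ , C = _ , subst₂ (Labeling _) (ℓ≡ t) (m≡ t q) (extend q C)
  where
  ℓ≡ : ∀ t → 10 + t * 4 ≡ 4 + suc (suc (suc (t + t))) * 2
  ℓ≡ = solve-∀
  m≡ : ∀ t q → 4 * suc (2 + t + q) + 3 ≡ 4 + suc (suc (suc (t + t))) * 2 + 5 + q * 4
  m≡ = solve-∀

labelable-1 : ∀ ℓ K → ℓ + 1 ≡ 1 + K * 4 → ℓ ≥ 8 → Labelable ℓ 1
labelable-1 ℓ K h ℓ≥8 with suc-injective (≡.trans (+-comm 1 ℓ) h)
labelable-1 _ (suc (suc t)) h ℓ≥8                   | refl = path-1 t
labelable-1 _ 1             h (s≤s (s≤s (s≤s (s≤s ())))) | refl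

labelable-3 : ∀ ℓ K → ℓ + 3 ≡ 1 + K * 4 → ℓ ≥ 8 → Labelable ℓ 3
labelable-3 ℓ (suc K) h ℓ≥8 with +-cancelˡ-≡ 3 ℓ (2 + K * 4) (≡.trans (+-comm 3 ℓ) h)
labelable-3 _ (suc (suc (suc t))) h ℓ≥8 | refl = path-3 t
labelable-3 _ 1 h (s≤s (s≤s ()))        | refl
labelable-3 _ 2 h (s≤s (s≤s (s≤s (s≤s (s≤s (s≤s ())))))) | refl
labelable-3 ℓ zero h ℓ≥8 = contradiction (≡.trans (+-comm 3 ℓ) h) λ ()

-- For even `ℓ` the sum `ℓ + (ℓ + 5)` is 1 modulo 4, so the congruence makes the excess `d` a
-- multiple of 4.
labelable-long : ∀ p d K → (2 + p) * 2 + ((2 + p) * 2 + 5 + d) ≡ 1 + K * 4 → Labelable ((2 + p) * 2) ((2 + p) * 2 + 5 + d)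
labelable-long p d K h = conclude (∣m+n∣m⇒∣n (divides K total) (divides (3 + p) refl))
  where
  regroup : ∀ p d → suc ((3 + p) * 4 + d) ≡ (2 + p) * 2 + ((2 + p) * 2 + 5 + d)
  regroup = solve-∀
  total : (3 + p) * 4 + d ≡ K * 4
  total = suc-injective (≡.trans (regroup p d) h)
  conclude : 4 ∣ d → Labelable ((2 + p) * 2) ((2 + p) * 2 + 5 + d)
  conclude (divides q d≡q*4) = subst (λ d → Labelable ((2 + p) * 2) ((2 + p) * 2 + 5 + d)) (sym d≡q*4) (long-path p q)

labelable-even : ∀ ℓ d K → ℓ ≥ 4 → 2 ∣ ℓ → ℓ + (ℓ + 5 + d) ≡ 1 + K * 4 → Labelable ℓ (ℓ + 5 + d)
labelable-even _ d K (s≤s (s≤s ()))  (divides-refl 1)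
labelable-even _ d K ℓ≥4 (divides-refl (suc (suc p))) h = labelable-long p d K h

theorem4p6 : (ℓ m : ℕ) → ℓ ≥ 4 → 2 ∣ ℓ → ¬ (2 ∣ m) → m ≥ 1 →
    (ℓ + m) % 4 ≡ 1 →
    (((m ≡ 1 ⊎ m ≡ 3) × ℓ ≥ 8) ⊎ m ≥ ℓ + 5) →
    Σ (List ℕ) (λ cyc → Σ (List ℕ) (λ pth →
    IsAL ℓ m ((ℓ + m ∸ 1) / 4) (3 * ((ℓ + m ∸ 1) / 4) + 1) cyc pth))
theorem4p6 ℓ m ℓ≥4 2∣ℓ _ _ ℓ+m%4≡1 cases = conclude (choose cases)
  where
  K = (ℓ + m) / 4
  ℓ+m≡1+4K : ℓ + m ≡ 1 + K * 4
  ℓ+m≡1+4K = ≡.trans (m≡m%n+[m/n]*n (ℓ + m) 4) (cong (_+ K * 4) ℓ+m%4≡1)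
  choose : (((m ≡ 1 ⊎ m ≡ 3) × ℓ ≥ 8) ⊎ m ≥ ℓ + 5) → Labelable ℓ m
  choose (inj₁ (inj₁ refl , ℓ≥8)) = labelable-1 ℓ K ℓ+m≡1+4K ℓ≥8
  choose (inj₁ (inj₂ refl , ℓ≥8)) = labelable-3 ℓ K ℓ+m≡1+4K ℓ≥8
  choose (inj₂ m≥ℓ+5)             = subst (Labelable ℓ) (m+[n∸m]≡n m≥ℓ+5)
    (labelable-even ℓ (m ∸ (ℓ + 5)) K ℓ≥4 2∣ℓ (≡.trans (cong (ℓ +_) (m+[n∸m]≡n m≥ℓ+5)) ℓ+m≡1+4K))
  conclude : Labelable ℓ m → Σ (List ℕ) (λ cyc → Σ (List ℕ) (λ pth →
    IsAL ℓ m ((ℓ + m ∸ 1) / 4) (3 * ((ℓ + m ∸ 1) / 4) + 1) cyc pth))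
  conclude (k , L) = subst (λ x → ∃ λ cyc → ∃ λ pth → IsAL ℓ m x (3 * x + 1) cyc pth) (sym quarter) (Labeling⇒IsAL L)
    where
    fourfold : ∀ k → k + k + (k + k) ≡ k * 4
    fourfold = solve-∀
    quarter : (ℓ + m ∸ 1) / 4 ≡ k
    quarter = begin
      (ℓ + m ∸ 1) / 4             ≡⟨ cong (λ ε → (ε ∸ 1) / 4) (Labeling-size L) ⟩
      (k + k + odd k ∸ 1) / 4     ≡⟨ cong (λ ε → (ε ∸ 1) / 4) (+-suc (k + k) (k + k)) ⟩
      (k + k + (k + k)) / 4       ≡⟨ cong (_/ 4) (fourfold k) ⟩
      k * 4 / 4                   ≡⟨ m*n/n≡m k 4 ⟩
      k ∎
      where open ≡-Reasoning
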